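{- Let $n\in\mathbb{N}$, $n\ge 1$, and let $f:\{0,1\}^n\to\{0,1\}^n$ be a Boolean network that is quasi-Hamiltonian, or Hamiltonian of maximum height, or Hamiltonian of intermediate height with $p(f)$ odd. Then the interaction graph $G(f)$ is strongly connected.
   Context: A Boolean network with $n$ variables is a map $f=(f_1,\dots,f_n):\{0,1\}^n\to\{0,1\}^n$; write $[n]=\{1,\dots,n\}$. Its dynamics is the digraph $\Gamma(f)$ with vertex set $\{0,1\}^n$ and arcs $(x,f(x))$, $x\in\{0,1\}^n$. A trajectory of $f$ is a path (directed walk along arcs) in $\Gamma(f)$ that does not repeat arcs. A fixed point is $x$ with $f(x)=x$; a limit cycle is a cycle of $\Gamma(f)$ of length at least two; an attractor is a fixed point or a limit cycle. The period $p(f)$ is the least common multiple of the lengths of all limit cycles of $f$. $f$ is Hamiltonian if $\Gamma(f)$ has a trajectory that visits all configurations of $\{0,1\}^n$ (hence $f$ has a unique attractor). A Hamiltonian $f$ is of maximum height if its only attractor is a fixed point, and of intermediate height if its unique attractor is a limit cycle of length $k\in\{2,3,\dots,2^n-1\}$. $f$ is quasi-Hamiltonian if $\Gamma(f)$ consists of a cycle of length $2^n-1$ and a fixed point. $f_j$ depends on $x_i$ if there is $x\in\{0,1\}^n$ with $f_j(x)\ne f_j(x\oplus e_i)$, where $e_i$ is the $i$-th unit vector and $\oplus$ is componentwise addition modulo 2. The interaction graph $G(f)$ is the digraph on $[n]$ with an arc $(i,j)$ (loops allowed) exactly when $f_j$ depends on $x_i$. -}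

module Defs where

open import Level using (Level; 0ℓ)
open import Data.Bool using (Bool; true; false; _xor_)
open import Data.Empty.Polymorphic using (⊥)
open import Data.Fin using (Fin)
open import Data.List using (List; []; _∷_; [_]; _++_; length; zip; drop)
open import Data.List.Membership.Propositional using (_∈_; _∉_)
open import Data.List.Relation.Binary.Permutation.Propositional using (_↭_)
open import Data.List.Relation.Unary.Linked using (Linked)
open import Data.List.Relation.Unary.Unique.Propositional using (Unique)
open import Data.Nat using (ℕ; _≤_; _∸_; _^_)
open import Data.Nat.Divisibility using (_∣_)
open import Data.Product using (_×_; ∃-syntax)
open import Data.Sum using (_⊎_)
open import Data.Vec using (Vec; lookup; replicate; zipWith; _[_]≔_)
open import Relation.Binary.Core using (Rel)
open import Relation.Binary.Construct.Closure.ReflexiveTransitive using (Star)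
open import Relation.Binary.PropositionalEquality using (_≡_; _≢_)
open import Relation.Nullary using (¬_)

private
  variable
    a ℓ : Level
    n : ℕ

-- A digraph on V is a relation Rel V ℓ; a walk is the list of the vertices it
-- visits, in order.

module _ {V : Set a} where

  walkArcs : List V → List (V × V)
  walkArcs xs = zip xs (drop 1 xs)

  IsTrajectory : Rel V ℓ → List V → Set _
  IsTrajectory _⟶_ xs = Linked _⟶_ xs × Unique (walkArcs xs)

  -- A cycle is listed once around from an arbitrary starting vertex, so its
  -- length is the length of the list; a loop is a cycle of length 1.
  IsCycle : Rel V ℓ → List V → Set _
  IsCycle _⟶_ []       = ⊥
  IsCycle _⟶_ (x ∷ xs) = Unique (x ∷ xs) × Linked _⟶_ (x ∷ xs ++ [ x ])

  -- The empty walk is allowed: a one-vertex digraph is strongly connected,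
  -- with or without a loop.
  StronglyConnected : Rel V ℓ → Set _
  StronglyConnected _⟶_ = ∀ u v → Star _⟶_ u v

Config : ℕ → Set
Config n = Vec Bool n

BooleanNetwork : ℕ → Set
BooleanNetwork n = Config n → Config n

_⊕_ : Config n → Config n → Config n
_⊕_ = zipWith _xor_

unit : Fin n → Config n
unit i = replicate _ false [ i ]≔ true

DependsOn : BooleanNetwork n → Fin n → Fin n → Set
DependsOn f j i = ∃[ x ] lookup (f x) j ≢ lookup (f (x ⊕ unit i)) j

InteractionGraph : BooleanNetwork n → Rel (Fin n) 0ℓ
InteractionGraph f i j = DependsOn f j i

Γ : BooleanNetwork n → Rel (Config n) 0ℓ
Γ f x y = f x ≡ y

module _ (f : BooleanNetwork n) where

  IsFixedPoint : Config n → Set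
  IsFixedPoint x = f x ≡ x

  IsLimitCycle : List (Config n) → Set
  IsLimitCycle c = IsCycle (Γ f) c × 2 ≤ length c

  IsAttractor : List (Config n) → Set
  IsAttractor c = (∃[ x ] (c ≡ [ x ] × IsFixedPoint x)) ⊎ IsLimitCycle c

  -- Listings of the same attractor differ by a rotation.  Since every vertex
  -- of Γ f has a single out-arc, two attractors with the same vertices are
  -- equal, so _↭_ is equality of attractors.
  IsUniqueAttractor : List (Config n) → Set
  IsUniqueAttractor c = IsAttractor c × (∀ d → IsAttractor d → d ↭ c)

  IsHamiltonian : Set
  IsHamiltonian = ∃[ xs ] (IsTrajectory (Γ f) xs × (∀ x → x ∈ xs))

  IsMaximumHeight : Set
  IsMaximumHeight =
    IsHamiltonian × ∃[ x ] (IsFixedPoint x × IsUniqueAttractor [ x ])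

  IsIntermediateHeight : Set
  IsIntermediateHeight =
    IsHamiltonian ×
    ∃[ c ] (IsLimitCycle c × IsUniqueAttractor c × length c ≤ 2 ^ n ∸ 1)

  -- For n = 1 the cycle has length 1, and f is the identity.
  IsQuasiHamiltonian : Set
  IsQuasiHamiltonian =
    ∃[ c ] ∃[ y ] ( IsCycle (Γ f) c × length c ≡ 2 ^ n ∸ 1
                  × IsFixedPoint y × y ∉ c
                  × (∀ x → x ∈ c ⊎ x ≡ y))

-- Least with respect to divisibility, as in Data.Nat.LCM; for an empty set of
-- numbers this gives 1.
record IsLCM (S : ℕ → Set) (p : ℕ) : Set where
  field
    commonMultiple : ∀ k → S k → k ∣ p
    least          : ∀ m → (∀ k → S k → k ∣ m) → p ∣ m

IsPeriod : BooleanNetwork n → ℕ → Set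
IsPeriod f = IsLCM (λ k → ∃[ c ] (IsLimitCycle f c × length c ≡ k))

Odd : ℕ → Set
Odd m = ¬ 2 ∣ m

{-# OPTIONS --safe #-}
-- If v is not reachable from u in G(f), let S be the set of variables from
-- which v is reachable.  Since S is closed under predecessors, agreement on S
-- is an equivalence ~ compatible with f.  The class of x contains x ⊕ unit u
-- but not x ⊕ unit v.
--
-- Quasi-Hamiltonian: the class of the fixed point y is stable under f and meets
-- the cycle in y ⊕ unit u, so it contains the whole cycle, including
-- y ⊕ unit v, a contradiction.
--
-- Hamiltonian: the orbit of x₀ covers all configurations and returns to the
-- class of x₀, so f permutes the classes cyclically.  Flipping coordinate v is
-- a free involution on the classes, so their number is even, and it divides the
-- length of every cycle of f, fixed points included.
module Submission where

import Algebra.Properties.CommutativeMonoid.Sum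
open import Data.Bool using (Bool; true; false; not; _xor_; if_then_else_)
open import Data.Bool.Properties
  using (not-¬; xor-assoc; xor-comm; xor-identityʳ; xor-same)
  renaming (_≟_ to _≟ᵇ_)
open import Data.Fin using (Fin; zero; suc; toℕ; fromℕ<)
open import Data.Fin.Permutation using (permutation)
open import Data.Fin.Properties
  using (all?; any?; toℕ<n; toℕ-fromℕ<; toℕ-injective)
open import Data.Fin.Subset using (Subset; _∈_; _∉_; _⊃_; _∪_; ⁅_⁆)
open import Data.Fin.Subset.Induction using (Acc; acc; ⊃-wellFounded)
open import Data.Fin.Subset.Properties
  using (_∈?_; anySubset?; p⊆p∪q; q⊆p∪q; x∈⁅x⁆; x∈⁅y⁆⇒x≡y; x∈p∪q⁻)
open import Data.List using ([]; _∷_; [_]; _++_; length)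
import Data.List.Membership.Propositional as List
open import Data.List.Membership.Propositional.Properties using (∈-++⁺ˡ)
open import Data.List.Relation.Unary.Any using (here; there)
open import Data.List.Relation.Unary.Linked using (Linked; _∷_)
open import Data.Nat
  using (ℕ; zero; suc; _+_; _*_; _∸_; _<_; _≥_; _<?_; s≤s; NonZero)
open import Data.Nat.DivMod using (_%_; _/_; m%n<n; m≡m%n+[m/n]*n)
open import Data.Nat.Divisibility
  using (_∣_; divides; _∣0; ∣-trans; ∣m∣n⇒∣m+n; ∣⇒≤)
open import Data.Nat.GeneralisedArithmetic
  using (fold; fold-+; iterate-is-fold)
open import Data.Nat.Induction using (<-rec)
open import Data.Nat.Properties
  using (+-0-commutativeMonoid; +-comm; +-identityʳ; *-comm; m∸n+n≡m; m<n⇒0<n∸m;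
         ∸-monoʳ-<; +-monoʳ-<; <⇒≤; <-cmp; <-≤-trans; m≤m+n; anyUpTo?)
open import Data.Nat.Solver using (module +-*-Solver)
open import Data.Product using (_×_; ∃-syntax; _,_; proj₁; proj₂)
open import Data.Sum using (_⊎_; inj₁; inj₂; [_,_]′)
open import Data.Vec using ([]; _∷_; lookup; replicate)
open import Data.Vec.Properties
  using (lookup-zipWith; lookup-replicate; lookup∘update; lookup∘update′;
         zipWith-identityʳ)
open import Function using (_∘_)
open import Level using (Level; 0ℓ)
open import Relation.Binary.Construct.Closure.ReflexiveTransitive
  using (Star; ε; _◅_)
import Relation.Binary.Construct.On as On
open import Relation.Binary.Core using (Rel)
open import Relation.Binary.Definitions using (Decidable; tri<; tri≈; tri>)
open import Relation.Binary.PropositionalEquality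
  using (_≡_; _≢_; refl; sym; trans; cong; cong₂; subst; subst₂; module ≡-Reasoning)
open import Relation.Binary.Structures using (IsDecEquivalence)
open import Relation.Nullary
  using (¬_; yes; no; ¬?; _×-dec_; _→-dec_; contradiction)
open import Relation.Nullary.Decidable using (decidable-stable)
open import Defs

open Algebra.Properties.CommutativeMonoid.Sum +-0-commutativeMonoid
  using (sum; sum-cong-≗; sum-permute; ∑-distrib-+)

private
  variable
    a ℓ : Level
    A : Set a
    n : ℕ

-- Reachability and predecessor-closed sets in a finite digraph

-- Grow `⁅ v ⁆`: as long as some arc enters the set from outside, add its tail. Strict growth among
-- subsets of a finite set is well-founded, and when no such arc is left the set is closed.
predecessorClosure : {E : Rel (Fin n) ℓ} → Decidable E → ∀ v →
  ∃[ S ] (v ∈ S × (∀ {i} → i ∈ S → Star E i v)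
               × (∀ {i j} → E i j → j ∈ S → i ∈ S))
predecessorClosure {n = n} {E = E} E? v =
  extend ⁅ v ⁆ (⊃-wellFounded _) (x∈⁅x⁆ v)
    (λ i∈ → subst (λ w → Star E w v) (sym (x∈⁅y⁆⇒x≡y v i∈)) ε)
  where
  extend : (S : Subset n) → Acc _⊃_ S → v ∈ S →
    (∀ {i} → i ∈ S → Star E i v) →
    ∃[ T ] (v ∈ T × (∀ {i} → i ∈ T → Star E i v)
                 × (∀ {i j} → E i j → j ∈ T → i ∈ T))
  extend S (acc rs) v∈S reach
    with any? (λ i → any? (λ j → ¬? (i ∈? S) ×-dec E? i j ×-dec (j ∈? S)))
  ... | no closed = S , v∈S , reach , λ {i} {j} e j∈S →
          decidable-stable (i ∈? S) (λ i∉S → closed (i , j , i∉S , e , j∈S))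
  ... | yes (i , j , i∉S , e , j∈S) =
          extend (S ∪ ⁅ i ⁆)
            (rs (p⊆p∪q ⁅ i ⁆ , i , q⊆p∪q S ⁅ i ⁆ (x∈⁅x⁆ i) , i∉S))
            (p⊆p∪q ⁅ i ⁆ v∈S)
            (λ k∈ → [ reach , fromNew ]′ (x∈p∪q⁻ S ⁅ i ⁆ k∈))
    where
    fromNew : ∀ {k} → k ∈ ⁅ i ⁆ → Star E k v
    fromNew k∈ rewrite x∈⁅y⁆⇒x≡y i k∈ = e ◅ reach j∈S

-- A configuration and a `Subset n` are both Boolean vectors, so the exhaustive search over subsets
-- ranges over all configurations.
interactionGraph? : (f : BooleanNetwork n) → Decidable (InteractionGraph f)
interactionGraph? f i j =
  anySubset? (λ x → ¬? (lookup (f x) j ≟ᵇ lookup (f (x ⊕ unit i)) j))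

-- Flipping one coordinate, and functions independent of coordinates

lookup-unit-≢ : ∀ {i j : Fin n} → i ≢ j → lookup (unit j) i ≡ false
lookup-unit-≢ {i = i} i≢j =
  trans (lookup∘update′ i≢j (replicate _ false) true) (lookup-replicate i false)

lookup-⊕-unit-≡ : ∀ (x : Config n) i → lookup (x ⊕ unit i) i ≡ not (lookup x i)
lookup-⊕-unit-≡ x i = begin
  lookup (x ⊕ unit i) i            ≡⟨ lookup-zipWith _xor_ i x (unit i) ⟩
  lookup x i xor lookup (unit i) i ≡⟨ cong (lookup x i xor_) (lookup∘update i (replicate _ false) true) ⟩
  lookup x i xor true              ≡⟨ xor-comm (lookup x i) true ⟩
  not (lookup x i)                 ∎
  where open ≡-Reasoning

lookup-⊕-unit-≢ : ∀ (x : Config n) {i j} → i ≢ j →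
  lookup (x ⊕ unit j) i ≡ lookup x i
lookup-⊕-unit-≢ x {i} {j} i≢j = begin
  lookup (x ⊕ unit j) i            ≡⟨ lookup-zipWith _xor_ i x (unit j) ⟩
  lookup x i xor lookup (unit j) i ≡⟨ cong (lookup x i xor_) (lookup-unit-≢ i≢j) ⟩
  lookup x i xor false             ≡⟨ xor-identityʳ _ ⟩
  lookup x i                       ∎
  where open ≡-Reasoning

⊕-unit-≢ : ∀ (x : Config n) i → x ⊕ unit i ≢ x
⊕-unit-≢ x i eq =
  not-¬ (cong (λ y → lookup y i) eq) (lookup-⊕-unit-≡ x i)

-- Turn `x` into `y` one coordinate at a time, from the head; wherever they differ, `φ` ignores that
-- coordinate. `φ` is arbitrary because the recursion fixes the head and passes to `φ ∘ (b ∷_)`.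
independent⇒≡ : (φ : Config n → Bool) (x y : Config n) →
  (∀ i → lookup x i ≡ lookup y i ⊎ (∀ z → φ z ≡ φ (z ⊕ unit i))) →
  φ x ≡ φ y
independent⇒≡ φ []      []      h = refl
independent⇒≡ φ (b ∷ x) (c ∷ y) h =
  trans (independent⇒≡ (φ ∘ (b ∷_)) x y tail-independent) (head-step (h zero))
  where
  tail-independent : ∀ i → lookup x i ≡ lookup y i
    ⊎ (∀ z → φ (b ∷ z) ≡ φ (b ∷ (z ⊕ unit i)))
  tail-independent i with h (suc i)
  ... | inj₁ eq  = inj₁ eq
  ... | inj₂ ind = inj₂ λ z → trans (ind (b ∷ z))
          (cong (λ d → φ (d ∷ (z ⊕ unit i))) (xor-identityʳ b))

  flip-head : (∀ z → φ z ≡ φ (z ⊕ unit zero)) → ∀ d → φ (d ∷ y) ≡ φ (not d ∷ y)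
  flip-head ind d = trans (ind (d ∷ y))
    (cong₂ (λ e z → φ (e ∷ z)) (xor-comm d true) (zipWith-identityʳ xor-identityʳ y))

  head-step : ∀ {b c} → b ≡ c ⊎ (∀ z → φ z ≡ φ (z ⊕ unit zero)) → φ (b ∷ y) ≡ φ (c ∷ y)
  head-step                 (inj₁ refl) = refl
  head-step {false} {false} (inj₂ _)    = refl
  head-step {false} {true}  (inj₂ ind)  = flip-head ind false
  head-step {true}  {false} (inj₂ ind)  = flip-head ind true
  head-step {true}  {true}  (inj₂ _)    = refl

-- Parity from a colour-swapping involution

sum-const-1 : ∀ k → sum {k} (λ _ → 1) ≡ k
sum-const-1 zero    = refl
sum-const-1 (suc k) = cong suc (sum-const-1 k)

-- Exactly one of `i` and `σ i` has colour `true`. Summing over all `i` counts the `true` elements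
-- twice, since `σ` is a permutation.
colour-swapping-involution⇒even : ∀ {k} (σ : Fin k → Fin k) (colour : Fin k → Bool) →
  (∀ i → σ (σ i) ≡ i) → (∀ i → colour (σ i) ≡ not (colour i)) → 2 ∣ k
colour-swapping-involution⇒even {k} σ colour σσ swaps = divides (sum trues) (begin
  k                                     ≡⟨ sum-const-1 k ⟨
  sum {k} (λ _ → 1)                     ≡⟨ sum-cong-≗ one-colour ⟨
  sum (λ i → trues i + trues (σ i))     ≡⟨ ∑-distrib-+ trues (trues ∘ σ) ⟩
  sum trues + sum (trues ∘ σ)           ≡⟨ cong (sum trues +_) (sum-permute trues (permutation σ σ σσ σσ)) ⟨
  sum trues + sum trues                 ≡⟨ cong (sum trues +_) (+-identityʳ _) ⟨
  2 * sum trues                         ≡⟨ *-comm 2 (sum trues) ⟩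
  sum trues * 2                         ∎)
  where
  open ≡-Reasoning
  trues : Fin k → ℕ
  trues i = if colour i then 1 else 0

  one-colour : ∀ i → trues i + trues (σ i) ≡ 1
  one-colour i rewrite swaps i with colour i
  ... | true  = refl
  ... | false = refl

-- Successor-compatible congruences on the natural numbers

module PeriodicCongruence {_≈_ : Rel ℕ ℓ} (isDecEquivalence : IsDecEquivalence _≈_)
  (suc-cong : ∀ {s t} → s ≈ t → suc s ≈ suc t) where

  open IsDecEquivalence isDecEquivalence
    renaming (refl to ≈-refl; sym to ≈-sym; trans to ≈-trans;
              reflexive to ≈-reflexive; _≟_ to _≈?_)

  +-congˡ : ∀ r {s t} → s ≈ t → (r + s) ≈ (r + t)
  +-congˡ zero    s≈t = s≈t
  +-congˡ (suc r) s≈t = suc-cong (+-congˡ r s≈t)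

  *-period : ∀ m {p} → p ≈ 0 → (m * p) ≈ 0
  *-period zero        p≈0 = ≈-refl
  *-period (suc m) {p} p≈0 = ≈-trans (+-congˡ p (*-period m p≈0))
    (≈-trans (≈-reflexive (+-identityʳ p)) p≈0)

  -- Since some `suc p` is equivalent to 0, there is no preperiod: `s` can be shifted forward to the
  -- multiple `suc p * s`, which is equivalent to 0, and the relation `k + s ≈ s` moves along with
  -- it.
  period-of-recurrent : ∀ {p k s} → suc p ≈ 0 → (k + s) ≈ s → k ≈ 0
  period-of-recurrent {p} {k} {s} p≈0 k+s≈s =
    ≈-trans (≈-sym k+ps≈k) (≈-trans k+ps≈ps ps≈0)
    where
    ps≈0 : (suc p * s) ≈ 0
    ps≈0 = ≈-trans (≈-reflexive (*-comm (suc p) s)) (*-period s p≈0)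

    k+ps≈k : (k + suc p * s) ≈ k
    k+ps≈k = ≈-trans (+-congˡ k ps≈0) (≈-reflexive (+-identityʳ k))

    k+ps≈ps : (k + suc p * s) ≈ (suc p * s)
    k+ps≈ps = ≈-trans (≈-reflexive (solve 3 (λ k s q → k :+ (s :+ q) := q :+ (k :+ s)) refl k s (p * s)))
      (≈-trans (+-congˡ (p * s) k+s≈s) (≈-reflexive (+-comm (p * s) s)))
      where open +-*-Solver

  module _ (flip : ℕ → ℕ) (colour : ℕ → Bool)
    (flip-cong : ∀ {s t} → s ≈ t → flip s ≈ flip t)
    (flip-involutive : ∀ t → flip (flip t) ≈ t)
    (colour-cong : ∀ {s t} → s ≈ t → colour s ≡ colour t)
    (colour-flip : ∀ t → colour (flip t) ≡ not (colour t)) where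

    module _ {k} .{{_ : NonZero k}} (k≈0 : k ≈ 0)
      (minimal : ∀ {p} → 0 < p → p < k → ¬ p ≈ 0) where

      %-≈ : ∀ t → (t % k) ≈ t
      %-≈ t = ≈-trans (≈-reflexive (sym (+-identityʳ _)))
        (≈-trans (+-congˡ (t % k) (≈-sym (*-period (t / k) k≈0)))
          (≈-reflexive (sym (m≡m%n+[m/n]*n t k))))

      -- Adding `k ∸ t` to both sides turns `t` into `k`, so `(k ∸ t) + s` would be a positive
      -- period below `k`.
      <⇒≉ : ∀ {s t} → s < t → t < k → ¬ s ≈ t
      <⇒≉ {s} {t} s<t t<k s≈t = minimal
        (<-≤-trans (m<n⇒0<n∸m t<k) (m≤m+n (k ∸ t) s))
        (subst ((k ∸ t) + s <_) (m∸n+n≡m (<⇒≤ t<k)) (+-monoʳ-< (k ∸ t) s<t))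
        (≈-trans (+-congˡ (k ∸ t) s≈t)
          (≈-trans (≈-reflexive (m∸n+n≡m (<⇒≤ t<k))) k≈0))

      <k⇒≈⇒≡ : ∀ {s t} → s < k → t < k → s ≈ t → s ≡ t
      <k⇒≈⇒≡ {s} {t} s<k t<k s≈t with <-cmp s t
      ... | tri< s<t _ _ = contradiction s≈t (<⇒≉ s<t t<k)
      ... | tri≈ _ s≡t _ = s≡t
      ... | tri> _ _ t<s = contradiction (≈-sym s≈t) (<⇒≉ t<s s<k)

      -- For minimal `k`, the numbers below `k` represent each class exactly once. Reducing `flip`
      -- modulo `k` therefore gives a true involution of `Fin k`, although `flip` itself is
      -- involutive only up to `≈`.
      minimalPeriod-even : 2 ∣ k
      minimalPeriod-even = colour-swapping-involution⇒even σ (colour ∘ toℕ)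
        (λ i → toℕ-injective (<k⇒≈⇒≡ (toℕ<n _) (toℕ<n i)
          (≈-trans (σ-≈ (σ i)) (≈-trans (flip-cong (σ-≈ i)) (flip-involutive _)))))
        (λ i → trans (colour-cong (σ-≈ i)) (colour-flip (toℕ i)))
        where
        σ : Fin k → Fin k
        σ i = fromℕ< (m%n<n (flip (toℕ i)) k)

        σ-≈ : ∀ i → toℕ (σ i) ≈ flip (toℕ i)
        σ-≈ i = ≈-trans (≈-reflexive (toℕ-fromℕ< _)) (%-≈ _)

    -- A non-minimal period k is the sum of two smaller ones, p and k ∸ p.
    period-even : ∀ k → k ≈ 0 → 2 ∣ k
    period-even = <-rec _ step
      where
      step : ∀ k → (∀ {p} → p < k → p ≈ 0 → 2 ∣ p) → k ≈ 0 → 2 ∣ k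
      step zero rec k≈0 = 2 ∣0
      step k@(suc _) rec k≈0 with anyUpTo? (λ p → (0 <? p) ×-dec (p ≈? 0)) k
      ... | no none = minimalPeriod-even k≈0
              (λ {p} 0<p p<k p≈0 → none (p , p<k , 0<p , p≈0))
      ... | yes (p , p<k , 0<p , p≈0) = subst (2 ∣_) (m∸n+n≡m (<⇒≤ p<k))
              (∣m∣n⇒∣m+n
                (rec (∸-monoʳ-< 0<p (<⇒≤ p<k))
                  (≈-trans (≈-trans (≈-reflexive (sym (+-identityʳ _)))
                                    (+-congˡ (k ∸ p) (≈-sym p≈0)))
                    (≈-trans (≈-reflexive (m∸n+n≡m (<⇒≤ p<k))) k≈0)))
                (rec p<k p≈0))

-- Walks and cycles as orbits

-- `fold` adds applications on the outside, whereas walks are consumed from their first vertex.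
fold-suc : ∀ (x : A) (f : A → A) t → fold x f (suc t) ≡ fold (f x) f t
fold-suc x f t = trans (iterate-is-fold x f (suc t)) (sym (iterate-is-fold (f x) f t))

module _ {f : BooleanNetwork n} where

  walk⊆orbit : ∀ {x xs y} → Linked (Γ f) (x ∷ xs) → y List.∈ x ∷ xs →
    ∃[ t ] fold x f t ≡ y
  walk⊆orbit         _             (here refl) = 0 , refl
  walk⊆orbit {x = x} (refl ∷ walk) (there y∈)  with walk⊆orbit walk y∈
  ... | t , eq = suc t , trans (fold-suc x f t) eq

  walk-end : ∀ {x y} xs → Linked (Γ f) (x ∷ xs ++ [ y ]) →
    fold x f (suc (length xs)) ≡ y
  walk-end         []       (fx≡y ∷ _)    = fx≡y
  walk-end {x = x} (_ ∷ xs) (refl ∷ walk) =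
    trans (fold-suc x f (suc (length xs))) (walk-end xs walk)

  cycle-period : ∀ {c} → IsCycle (Γ f) c → ∃[ x ] fold x f (length c) ≡ x
  cycle-period {x ∷ xs} (_ , walk) = x , walk-end xs walk

  cycle⊆orbit : ∀ {x xs y} → IsCycle (Γ f) (x ∷ xs) → y List.∈ x ∷ xs →
    ∃[ t ] fold x f t ≡ y
  cycle⊆orbit (_ , walk) y∈ = walk⊆orbit walk (∈-++⁺ˡ y∈)

  hamiltonian⇒orbit : IsHamiltonian f → ∃[ x ] ∀ y → ∃[ t ] fold x f t ≡ y
  hamiltonian⇒orbit ([] , _ , covers) with () ← covers (replicate _ false)
  hamiltonian⇒orbit (x ∷ xs , (walk , _) , covers) =
    x , λ y → walk⊆orbit walk (covers y)

-- Agreement on a predecessor-closed set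

module ClosedSet (f : BooleanNetwork n) (S : Subset n)
  (closed : ∀ {i j} → InteractionGraph f i j → j ∈ S → i ∈ S)
  {u v : Fin n} (u∉S : u ∉ S) (v∈S : v ∈ S) where

  infix 4 _~_
  _~_ : Rel (Config n) 0ℓ
  x ~ y = ∀ i → i ∈ S → lookup x i ≡ lookup y i

  ~-isDecEquivalence : IsDecEquivalence _~_
  ~-isDecEquivalence = record
    { isEquivalence = record
      { refl  = λ _ _ → refl
      ; sym   = λ x~y i i∈S → sym (x~y i i∈S)
      ; trans = λ x~y y~z i i∈S → trans (x~y i i∈S) (y~z i i∈S)
      }
    ; _≟_ = λ x y → all? (λ i → (i ∈? S) →-dec (lookup x i ≟ᵇ lookup y i))
    }

  open IsDecEquivalence ~-isDecEquivalence
    using () renaming (reflexive to ~-reflexive)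

  -- For `j` in `S`, any variable on which coordinate `j` of `f` depends is a predecessor of `j` and
  -- so lies in `S`, where `x` and `y` agree.
  f-cong : ∀ {x y} → x ~ y → f x ~ f y
  f-cong {x} {y} x~y j j∈S = independent⇒≡ (λ z → lookup (f z) j) x y agree
    where
    agree : ∀ i → lookup x i ≡ lookup y i
      ⊎ (∀ z → lookup (f z) j ≡ lookup (f (z ⊕ unit i)) j)
    agree i with i ∈? S
    ... | yes i∈S = inj₁ (x~y i i∈S)
    ... | no  i∉S = inj₂ λ z → decidable-stable (_ ≟ᵇ _)
            (λ neq → i∉S (closed (z , neq) j∈S))

  fold-cong : ∀ t {x y} → x ~ y → fold x f t ~ fold y f t
  fold-cong zero    x~y = x~y
  fold-cong (suc t) x~y = f-cong (fold-cong t x~y)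

  ⊕-unit-u : ∀ x → x ⊕ unit u ~ x
  ⊕-unit-u x i i∈S = lookup-⊕-unit-≢ x λ { refl → u∉S i∈S }

  ⊕-unit-v : ∀ x → ¬ x ⊕ unit v ~ x
  ⊕-unit-v x x⊕v~x = not-¬ (x⊕v~x v v∈S) (lookup-⊕-unit-≡ x v)

  ⊕-cong : ∀ {x y} z → x ~ y → x ⊕ z ~ y ⊕ z
  ⊕-cong {x} {y} z x~y i i∈S = begin
    lookup (x ⊕ z) i          ≡⟨ lookup-zipWith _xor_ i x z ⟩
    lookup x i xor lookup z i ≡⟨ cong (_xor lookup z i) (x~y i i∈S) ⟩
    lookup y i xor lookup z i ≡⟨ lookup-zipWith _xor_ i y z ⟨
    lookup (y ⊕ z) i          ∎
    where open ≡-Reasoning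

  ⊕-involutive : ∀ x z → (x ⊕ z) ⊕ z ~ x
  ⊕-involutive x z i _ = begin
    lookup ((x ⊕ z) ⊕ z) i                     ≡⟨ lookup-zipWith _xor_ i (x ⊕ z) z ⟩
    lookup (x ⊕ z) i xor lookup z i            ≡⟨ cong (_xor lookup z i) (lookup-zipWith _xor_ i x z) ⟩
    (lookup x i xor lookup z i) xor lookup z i ≡⟨ xor-assoc (lookup x i) _ _ ⟩
    lookup x i xor (lookup z i xor lookup z i) ≡⟨ cong (lookup x i xor_) (xor-same (lookup z i)) ⟩
    lookup x i xor false                       ≡⟨ xor-identityʳ _ ⟩
    lookup x i                                 ∎
    where open ≡-Reasoning

  -- The quasi-Hamiltonian case

  ¬quasiHamiltonian : ¬ IsQuasiHamiltonian f
  ¬quasiHamiltonian (x ∷ xs , y , cycle , _ , fy≡y , _ , covers) =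
    ⊕-unit-v y (cycle~y (⊕-unit∈cycle v))
    where
    ⊕-unit∈cycle : ∀ i → y ⊕ unit i List.∈ x ∷ xs
    ⊕-unit∈cycle i with covers (y ⊕ unit i)
    ... | inj₁ ∈c = ∈c
    ... | inj₂ eq = contradiction eq (⊕-unit-≢ y i)

    fold-y : ∀ t → fold y f t ≡ y
    fold-y zero    = refl
    fold-y (suc t) = trans (cong f (fold-y t)) fy≡y

    ~y-stable : ∀ t {w} → w ~ y → fold w f t ~ y
    ~y-stable t {w} w~y = subst (fold w f t ~_) (fold-y t) (fold-cong t {w} w~y)

    fold-*-period : ∀ m → fold x f (m * suc (length xs)) ≡ x
    fold-*-period zero    = refl
    fold-*-period (suc m) = trans (fold-+ x f (suc (length xs)))
      (trans (cong (λ w → fold w f (suc (length xs))) (fold-*-period m))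
        (proj₂ (cycle-period cycle)))

    x~y : x ~ y
    x~y with cycle⊆orbit cycle (⊕-unit∈cycle u)
    -- `y ⊕ unit u` is reached after `a` steps. Another `length xs * a` steps complete `a` full
    -- turns and end at `x`, without leaving the class of `y`.
    ... | a , fᵃx≡y⊕u = subst (_~ y) returns
            (~y-stable (length xs * a) (subst (_~ y) (sym fᵃx≡y⊕u) (⊕-unit-u y)))
      where
      returns : fold (fold x f a) f (length xs * a) ≡ x
      returns = trans (sym (fold-+ x f (length xs * a)))
        (trans (cong (fold x f) (trans (+-comm _ a) (*-comm (suc (length xs)) a)))
          (fold-*-period a))

    cycle~y : ∀ {w} → w List.∈ x ∷ xs → w ~ y
    cycle~y w∈ with cycle⊆orbit cycle w∈
    ... | b , refl = ~y-stable b x~y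

  -- The Hamiltonian case

  hamiltonian⇒even-period : IsHamiltonian f → ∀ {z} k → fold z f k ≡ z → 2 ∣ k
  hamiltonian⇒even-period hamiltonian {z} k fᵏz≡z with hamiltonian⇒orbit hamiltonian
  ... | x₀ , index = period-even flip (λ t → lookup (orbit t) v)
          (λ {s} {t} → flip-cong {s} {t}) flip-involutive (λ s≈t → s≈t v v∈S) colour-flip
          k (period-of-recurrent {proj₁ returns} {k} {s} (proj₂ returns) k+s≈s)
    where
    orbit : ℕ → Config n
    orbit = fold x₀ f

    -- Times are identified when the orbit is in the same class, so classes of configurations become
    -- classes of natural numbers.
    open PeriodicCongruence (On.isDecEquivalence orbit ~-isDecEquivalence) f-cong

    -- A time at which the orbit visits the current configuration with coordinate `v` flipped; the
    -- value of coordinate `v` serves as the colour.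
    flip : ℕ → ℕ
    flip t = proj₁ (index (orbit t ⊕ unit v))

    orbit-flip : ∀ t → orbit (flip t) ≡ orbit t ⊕ unit v
    orbit-flip t = proj₂ (index (orbit t ⊕ unit v))

    flip-cong : ∀ {s t} → orbit s ~ orbit t → orbit (flip s) ~ orbit (flip t)
    flip-cong {s} {t} s≈t =
      subst₂ _~_ (sym (orbit-flip s)) (sym (orbit-flip t)) (⊕-cong {orbit s} {orbit t} (unit v) s≈t)

    flip-involutive : ∀ t → orbit (flip (flip t)) ~ orbit t
    flip-involutive t = subst (_~ orbit t)
      (sym (trans (orbit-flip (flip t)) (cong (_⊕ unit v) (orbit-flip t))))
      (⊕-involutive (orbit t) (unit v))

    colour-flip : ∀ t → lookup (orbit (flip t)) v ≡ not (lookup (orbit t) v)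
    colour-flip t =
      trans (cong (λ x → lookup x v) (orbit-flip t)) (lookup-⊕-unit-≡ (orbit t) v)

    -- The orbit visits `x₀ ⊕ unit u`, which is in the class of `x₀` but differs from `x₀`, so the
    -- visit occurs at a positive time.
    returns : ∃[ t ] orbit (suc t) ~ x₀
    returns with index (x₀ ⊕ unit u)
    ... | zero  , eq = contradiction (sym eq) (⊕-unit-≢ x₀ u)
    ... | suc t , eq = t , subst (_~ x₀) (sym eq) (⊕-unit-u x₀)

    s : ℕ
    s = proj₁ (index z)

    k+s≈s : orbit (k + s) ~ orbit s
    k+s≈s = ~-reflexive (trans (fold-+ x₀ f k)
      (trans (cong (λ w → fold w f k) (proj₂ (index z)))
        (trans fᵏz≡z (sym (proj₂ (index z))))))

  -- Combining the three cases

  impossible : ¬ (IsQuasiHamiltonian f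
    ⊎ IsMaximumHeight f
    ⊎ (IsIntermediateHeight f × ∃[ p ] (IsPeriod f p × Odd p)))
  impossible (inj₁ quasi) = ¬quasiHamiltonian quasi
  -- A fixed point returns after one step, so 2 would divide 1.
  impossible (inj₂ (inj₁ (hamiltonian , x , fixed , _)))
    with hamiltonian⇒even-period hamiltonian 1 fixed
  ... | 2∣1 = contradiction (∣⇒≤ 2∣1) λ { (s≤s ()) }
  -- The even length of the limit cycle divides the period, which contradicts oddness.
  impossible (inj₂ (inj₂ ((hamiltonian , c , limitCycle , _) , p , period , odd))) =
    odd (∣-trans
      (hamiltonian⇒even-period hamiltonian (length c)
        (proj₂ (cycle-period (proj₁ limitCycle))))
      (IsLCM.commonMultiple period (length c) (c , limitCycle , refl)))

theorem3p4 : (n : ℕ) → n ≥ 1 → (f : BooleanNetwork n) →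
    IsQuasiHamiltonian f
    ⊎ IsMaximumHeight f
    ⊎ (IsIntermediateHeight f × ∃[ p ] (IsPeriod f p × Odd p)) →
    StronglyConnected (InteractionGraph f)
theorem3p4 n _ f hyp u v with predecessorClosure (interactionGraph? f) v
... | S , v∈S , reach , closed with u ∈? S
... | yes u∈S = reach u∈S
... | no  u∉S = contradiction hyp (ClosedSet.impossible f S closed u∉S v∈S)
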